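{- Let $n\ge 3$ and let $W_n = K_1\vee C_n$ be the wheel graph. Then $l_{\max}(W_n) = l(-W_n) = \lceil \frac{n}{2}\rceil$. Additionally, when $n$ is odd, the switching class of $-W_n$ is the unique switching class that maximises the frustration index of $W_n$. When $n$ is even, a signed graph $(W_n,\sigma)$ maximises the frustration index (i.e. $l(W_n,\sigma)=l_{\max}(W_n)$) if and only if it contains $\frac{n}{2}$ pairwise edge-disjoint negative triangles.
   Context: All graphs are finite, simple and undirected. A signed graph $\Sigma=(G,\sigma)$ is a graph $G$ with a signature $\sigma:E(G)\to\{+1,-1\}$. The sign of a cycle is the product of the signs of its edges; $\Sigma$ is balanced if all its cycles are positive. The frustration index $l(\Sigma)$ is the minimum number of edges whose deletion makes $\Sigma$ balanced; it is invariant under switching. $-G$ is $G$ with all edges signed $-1$. $l_{\max}(G)=\max_\sigma l(G,\sigma)$. Switching $\Sigma$ at a vertex subset $X$ negates the signs of all edges with exactly one endpoint in $X$; a switching class is an equivalence class of signatures of $G$ under switching. $C_n$ is the cycle on $n$ vertices and $\vee$ denotes the join of vertex-disjoint graphs. -}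

module Defs where

open import Data.Bool.Base using (Bool; true; false; T; not; _∧_; _xor_; if_then_else_)
open import Data.Bool.Properties using (T-∧; T-irrelevant; T?)
open import Data.Empty using (⊥-elim)
open import Data.Fin.Base using (Fin; zero; suc; toℕ; fromℕ<; splitAt; combine; remQuot)
import Data.Fin.Properties as Fin
open import Data.Fin.Subset using (Subset)
open import Data.Fin.Subset.Properties using (anySubset?)
open import Data.List.Base using (List; []; _∷_; length; allFin; concatMap; deduplicate)
import Data.List.Base as List
open import Data.List.Membership.Propositional using () renaming (_∈_ to _∈ₚ_)
open import Data.List.Membership.Propositional.Properties using (∈-allFin; ∈-concatMap⁺)
import Data.List.Membership.Setoid as SetoidMembership
import Data.List.Membership.Setoid.Properties as SetoidMembershipₚ
open import Data.List.Relation.Unary.All using (All; []; _∷_)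
import Data.List.Relation.Unary.All as All
open import Data.List.Relation.Unary.Any using (Any; here; there)
import Data.List.Relation.Unary.Any as Any
open import Data.List.Relation.Unary.AllPairs using (_∷_; allPairs?)
import Data.List.Relation.Unary.Unique.DecSetoid.Properties as UniqueDecSetoid
import Data.List.Relation.Unary.Unique.Propositional as Propositional
import Data.List.Relation.Unary.Unique.Setoid as UniqueSetoid
open import Data.Nat.Base using (ℕ; zero; suc; _+_; _≤_; _<_; z≤n; s≤s)
import Data.Nat.Base as ℕ using (_*_)
import Data.Nat.Properties as ℕ
open import Data.Product using (Σ; ∃; ∃-syntax; _×_; _,_; proj₁; proj₂; uncurry)
open import Data.Sign.Base using (Sign; _*_; opposite) renaming (+ to pos; - to neg)
import Data.Sign.Properties as Sign
open import Data.Sum.Base using (_⊎_; inj₁; inj₂; swap)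
open import Data.Vec.Base using (lookup; tabulate)
open import Data.Vec.Properties using (lookup∘tabulate)
open import Function.Base using (_∘_)
open import Function.Bundles using (Equivalence)
open import Level using (0ℓ)
open import Relation.Binary.Bundles using (DecSetoid; Setoid)
open import Relation.Binary.Definitions using (tri<; tri≈; tri>)
open import Relation.Binary.PropositionalEquality
open import Relation.Nullary using (¬_; Dec; yes; no)
open import Relation.Nullary.Decidable
  using (⌊_⌋; map′; _×-dec_; _⊎-dec_; ¬?; toWitness; fromWitness; toWitnessFalse;
         fromWitnessFalse; decidable-stable)

Least : (ℕ → Set) → ℕ → Set
Least P k = P k × (∀ j → P j → k ≤ j)

Greatest : (ℕ → Set) → ℕ → Set
Greatest P k = P k × (∀ j → P j → j ≤ k)

least : (P : ℕ → Set) → (∀ k → Dec (P k)) → ∀ b → P b → ∃ (Least P)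
least P P? zero    p = 0 , p , λ _ _ → z≤n
least P P? (suc b) p with P? 0
... | yes p₀ = 0 , p₀ , λ _ _ → z≤n
... | no ¬p₀ with least (P ∘ suc) (P? ∘ suc) b p
...   | k , pk , k-least = suc k , pk ,
        λ { zero p₀ → ⊥-elim (¬p₀ p₀) ; (suc j) pj → s≤s (k-least j pj) }

greatest : (P : ℕ → Set) → (∀ k → Dec (P k)) → ∀ b → (∀ j → P j → j ≤ b) →
           ∃ P → ∃ (Greatest P)
greatest P P? b bound (k , pk) with P? b
... | yes pb = b , pb , bound
greatest P P? zero    bound (k , pk) | no ¬pb =
  ⊥-elim (¬pb (subst P (ℕ.n≤0⇒n≡0 (bound k pk)) pk))
greatest P P? (suc b) bound (k , pk) | no ¬pb =
  greatest P P? b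
    (λ j pj → ℕ.≤-pred (ℕ.≤∧≢⇒< (bound j pj) λ { refl → ¬pb pj })) (k , pk)

record Graph (m : ℕ) : Set where
  field
    adj        : Fin m → Fin m → Bool
    adj-sym    : ∀ u v → T (adj u v) → T (adj v u)
    adj-irrefl : ∀ u → ¬ T (adj u u)

  Adj : Fin m → Fin m → Set
  Adj u v = T (adj u v)

open Graph public using (Adj)

-- Each edge occurs with both orientations; _≈ᴱ_ identifies the two.
record Edge {m : ℕ} (G : Graph m) : Set where
  constructor edge
  field
    src tgt  : Fin m
    adjacent : Adj G src tgt

open Edge public

module _ {m : ℕ} {G : Graph m} where

  Joins : Edge G → Fin m → Fin m → Set
  Joins e u v = (src e ≡ u × tgt e ≡ v) ⊎ (src e ≡ v × tgt e ≡ u)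

  joins? : ∀ e u v → Dec (Joins e u v)
  joins? e u v = (src e Fin.≟ u ×-dec tgt e Fin.≟ v) ⊎-dec
                 (src e Fin.≟ v ×-dec tgt e Fin.≟ u)

  infix 4 _≈ᴱ_

  _≈ᴱ_ : Edge G → Edge G → Set
  e ≈ᴱ f = Joins e (src f) (tgt f)

  ≈ᴱ-sym : ∀ {e f} → e ≈ᴱ f → f ≈ᴱ e
  ≈ᴱ-sym (inj₁ (refl , refl)) = inj₁ (refl , refl)
  ≈ᴱ-sym (inj₂ (refl , refl)) = inj₂ (refl , refl)

  ≈ᴱ-trans : ∀ {e f g} → e ≈ᴱ f → f ≈ᴱ g → e ≈ᴱ g
  ≈ᴱ-trans (inj₁ (refl , refl)) q = q
  ≈ᴱ-trans (inj₂ (refl , refl)) (inj₁ (refl , refl)) = inj₂ (refl , refl)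
  ≈ᴱ-trans (inj₂ (refl , refl)) (inj₂ (refl , refl)) = inj₁ (refl , refl)

edgeDecSetoid : {m : ℕ} → Graph m → DecSetoid 0ℓ 0ℓ
edgeDecSetoid G = record
  { Carrier = Edge G
  ; _≈_     = _≈ᴱ_
  ; isDecEquivalence = record
    { isEquivalence = record
      { refl  = inj₁ (refl , refl)
      ; sym   = λ {e} {f} → ≈ᴱ-sym {e = e} {f = f}
      ; trans = λ {e} {f} {g} → ≈ᴱ-trans {e = e} {f = f} {g = g}
      }
    ; _≟_ = λ e f → joins? e (src f) (tgt f)
    }
  }

edgeSetoid : {m : ℕ} → Graph m → Setoid 0ℓ 0ℓ
edgeSetoid G = DecSetoid.setoid (edgeDecSetoid G)

module _ {m : ℕ} {G : Graph m} where
  open UniqueSetoid (edgeSetoid G) public using () renaming (Unique to DistinctEdges)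

data Walk {m : ℕ} (G : Graph m) : Fin m → Fin m → Set where
  []    : ∀ {u} → Walk G u u
  _∷_   : ∀ {u v w} → Adj G u v → Walk G v w → Walk G u w

module _ {m : ℕ} {G : Graph m} where

  walkLength : ∀ {u w} → Walk G u w → ℕ
  walkLength []      = 0
  walkLength (_ ∷ w) = suc (walkLength w)

  -- The final vertex is omitted, so a closed walk lists its base point once.
  vertices : ∀ {u w} → Walk G u w → List (Fin m)
  vertices []              = []
  vertices (_∷_ {u} _ w) = u ∷ vertices w

  edges : ∀ {u w} → Walk G u w → List (Edge G)
  edges []                  = []
  edges (_∷_ {u} {v} p w) = edge u v p ∷ edges w

record Cycle {m : ℕ} (G : Graph m) : Set where
  constructor cycle
  field
    base     : Fin m
    walk     : Walk G base base
    length≥3 : 3 ≤ walkLength walk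
    distinct : Propositional.Unique (vertices walk)

open Cycle public using (walk)

cycleEdges : {m : ℕ} {G : Graph m} → Cycle G → List (Edge G)
cycleEdges c = edges (walk c)

EdgeDisjoint : {m : ℕ} {G : Graph m} → Cycle G → Cycle G → Set
EdgeDisjoint c d = All (λ e → All (λ f → ¬ e ≈ᴱ f) (cycleEdges d)) (cycleEdges c)

module _ {m : ℕ} (G : Graph m) where

  Deleted : List (Edge G) → Fin m → Fin m → Set
  Deleted ds u v = Any (λ e → Joins e u v) ds

  deleted? : ∀ ds u v → Dec (Deleted ds u v)
  deleted? ds u v = Any.any? (λ e → joins? e u v) ds

  delete : List (Edge G) → Graph m
  delete ds = record
    { adj        = λ u v → Graph.adj G u v ∧ not ⌊ deleted? ds u v ⌋
    ; adj-sym    = λ u v p → let (a , d) = Equivalence.to T-∧ p in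
        Equivalence.from T-∧
          ( Graph.adj-sym G u v a
          , fromWitnessFalse {a? = deleted? ds v u}
              (toWitnessFalse {a? = deleted? ds u v} d ∘ Any.map swap) )
    ; adj-irrefl = λ u p → Graph.adj-irrefl G u (proj₁ (Equivalence.to T-∧ p))
    }

  delete-⊆ : ∀ ds {u v} → Adj (delete ds) u v → Adj G u v
  delete-⊆ ds p = proj₁ (Equivalence.to T-∧ p)

-- Symmetry for arbitrary p and q makes the sign a function of the
-- undirected edge uv.
record Signature {m : ℕ} (G : Graph m) : Set where
  field
    sgn     : ∀ u v → Adj G u v → Sign
    sgn-sym : ∀ u v (p : Adj G u v) (q : Adj G v u) → sgn u v p ≡ sgn v u q

open Signature public

infix 4 _≈ˢ_

_≈ˢ_ : {m : ℕ} {G : Graph m} → Signature G → Signature G → Set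
σ ≈ˢ τ = ∀ u v p → sgn σ u v p ≡ sgn τ u v p

allNegative : {m : ℕ} (G : Graph m) → Signature G
allNegative G = record { sgn = λ _ _ _ → neg ; sgn-sym = λ _ _ _ _ → refl }

restrict : {m : ℕ} {G : Graph m} → Signature G → (ds : List (Edge G)) →
           Signature (delete G ds)
restrict {G = G} σ ds = record
  { sgn     = λ u v p → sgn σ u v (delete-⊆ G ds p)
  ; sgn-sym = λ u v p q → sgn-sym σ u v (delete-⊆ G ds p) (delete-⊆ G ds q)
  }

switch : {m : ℕ} {G : Graph m} → Subset m → Signature G → Signature G
switch {m} {G} X σ = record { sgn = s ; sgn-sym = s-sym }
  where
  s : ∀ u v → Adj G u v → Sign
  s u v p = if lookup X u xor lookup X v then opposite (sgn σ u v p) else sgn σ u v p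

  s-sym : ∀ u v (p : Adj G u v) (q : Adj G v u) → s u v p ≡ s v u q
  s-sym u v p q rewrite sgn-sym σ u v p q with lookup X u | lookup X v
  ... | true  | true  = refl
  ... | true  | false = refl
  ... | false | true  = refl
  ... | false | false = refl

SwitchingEquivalent : {m : ℕ} {G : Graph m} → Signature G → Signature G → Set
SwitchingEquivalent {m} σ τ = ∃[ X ] switch {m} X σ ≈ˢ τ

module _ {m : ℕ} {G : Graph m} where

  walkSign : Signature G → ∀ {u w} → Walk G u w → Sign
  walkSign σ []                = pos
  walkSign σ (_∷_ {u} {v} p w) = sgn σ u v p * walkSign σ w

  cycleSign : Signature G → Cycle G → Sign
  cycleSign σ c = walkSign σ (walk c)

Balanced : {m : ℕ} {G : Graph m} → Signature G → Set
Balanced {G = G} σ = (c : Cycle G) → cycleSign σ c ≡ pos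

module _ {m : ℕ} {G : Graph m} where

  BalancedByDeleting : Signature G → ℕ → Set
  BalancedByDeleting σ k = ∃[ ds ] DistinctEdges ds × length ds ≡ k × Balanced (restrict σ ds)

  NegativeTriangle : Signature G → Set
  NegativeTriangle σ = Σ (Cycle G) λ c → walkLength (walk c) ≡ 3 × cycleSign σ c ≡ neg

  DisjointNegativeTriangles : Signature G → ℕ → Set
  DisjointNegativeTriangles σ k =
    ∃[ t ] (∀ (i j : Fin k) → i ≢ j → EdgeDisjoint (triangle t i) (triangle t j))
    where
    triangle : (Fin k → NegativeTriangle σ) → Fin k → Cycle G
    triangle t i = proj₁ (t i)

module _ {m : ℕ} {G : Graph m} where

  anyWalk? : ∀ k {u w} {P : Walk G u w → Set} → (∀ c → Dec (P c)) →
             Dec (∃[ c ] walkLength c ≡ k × P c)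
  anyWalk? zero {u} {w} P? with u Fin.≟ w
  ... | no u≢w   = no λ { ([] , _) → u≢w refl }
  ... | yes refl = map′ (λ p → [] , refl , p) (λ { ([] , _ , p) → p }) (P? [])
  anyWalk? (suc k) {u} {w} {P} P? =
    map′ (λ { (v , p , c , refl , r) → p ∷ c , refl , r })
         (λ { (_∷_ {v = v} p c , refl , r) → v , p , c , refl , r })
         (Fin.any? λ v → arc? v)
    where
    Rest : ∀ v → Adj G u v → Set
    Rest v p = ∃[ c ] walkLength c ≡ k × P (p ∷ c)

    arc? : ∀ v → Dec (∃ (Rest v))
    arc? v with T? (Graph.adj G u v)
    ... | no ¬p = no (¬p ∘ proj₁)
    ... | yes p = map′ (p ,_) (λ (q , r) → subst (Rest v) (T-irrelevant q p) r)
                       (anyWalk? k λ c → P? (p ∷ c))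

  length-vertices : ∀ {u w} (c : Walk G u w) → length (vertices c) ≡ walkLength c
  length-vertices []      = refl
  length-vertices (_ ∷ c) = cong suc (length-vertices c)

  lookup-∈ : (xs : List (Fin m)) (i : Fin (length xs)) → List.lookup xs i ∈ₚ xs
  lookup-∈ (x ∷ xs) zero    = here refl
  lookup-∈ (x ∷ xs) (suc i) = there (lookup-∈ xs i)

  unique-injective : ∀ {xs : List (Fin m)} → Propositional.Unique xs →
                     ∀ {i j} → List.lookup xs i ≡ List.lookup xs j → i ≡ j
  unique-injective (x∉ ∷ u) {zero}  {zero}  _  = refl
  unique-injective {x ∷ xs} (x∉ ∷ u) {zero}  {suc j} eq =
    ⊥-elim (All.lookup x∉ (lookup-∈ xs j) eq)
  unique-injective {x ∷ xs} (x∉ ∷ u) {suc i} {zero}  eq =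
    ⊥-elim (All.lookup x∉ (lookup-∈ xs i) (sym eq))
  unique-injective (x∉ ∷ u) {suc i} {suc j} eq = cong suc (unique-injective u eq)

  cycle-length : (c : Cycle G) → walkLength (walk c) ≤ m
  cycle-length (cycle _ w _ d) =
    subst (_≤ m) (length-vertices w) (Fin.injective⇒≤ (unique-injective d))

module _ {m : ℕ} {G : Graph m} where

  balanced? : (σ : Signature G) → Dec (Balanced σ)
  balanced? σ = map′ to from (¬? negativeCycle?)
    where
    IsNegative : ∀ {b} → Walk G b b → Set
    IsNegative w = (3 ≤ walkLength w × Propositional.Unique (vertices w)) × walkSign σ w ≢ pos

    negative? : ∀ {b} (w : Walk G b b) → Dec (IsNegative w)
    negative? w = (3 ℕ.≤? walkLength w ×-dec allPairs? (λ x y → ¬? (x Fin.≟ y)) (vertices w))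
                  ×-dec ¬? (walkSign σ w Sign.≟ pos)

    NegativeCycle : Set
    NegativeCycle = ∃[ b ] ∃[ k ] Σ (Walk G b b) λ w →
                    walkLength w ≡ toℕ {suc m} k × IsNegative w

    negativeCycle? : Dec NegativeCycle
    negativeCycle? = Fin.any? λ b → Fin.any? λ k → anyWalk? (toℕ k) negative?

    to : ¬ NegativeCycle → Balanced σ
    to none c@(cycle b w l d) = decidable-stable (_ Sign.≟ _) λ ≢pos →
      none (b , fromℕ< (s≤s (cycle-length c)) , w , sym (Fin.toℕ-fromℕ< _) , (l , d) , ≢pos)

    from : Balanced σ → ¬ NegativeCycle
    from bal (b , _ , w , _ , (l , d) , ≢pos) = ≢pos (bal (cycle b w l d))

module _ {m : ℕ} {G : Graph m} where

  anyEdge? : {P : Edge G → Set} → (∀ e → Dec (P e)) → Dec (∃ P)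
  anyEdge? {P} P? =
    map′ (λ (u , v , p , r) → edge u v p , r) (λ (edge u v p , r) → u , v , p , r)
         (Fin.any? λ u → Fin.any? λ v → at? u v)
    where
    at? : ∀ u v → Dec (∃[ p ] P (edge u v p))
    at? u v with T? (Graph.adj G u v)
    ... | no ¬p = no (¬p ∘ proj₁)
    ... | yes p = map′ (p ,_) (λ (q , r) → subst (P ∘ edge u v) (T-irrelevant q p) r)
                       (P? (edge u v p))

  anyEdgeList? : ∀ k {P : List (Edge G) → Set} → (∀ ds → Dec (P ds)) →
                 Dec (∃[ ds ] length ds ≡ k × P ds)
  anyEdgeList? zero    P? = map′ (λ p → [] , refl , p) (λ { ([] , _ , p) → p }) (P? [])
  anyEdgeList? (suc k) P? =
    map′ (λ { (e , ds , refl , p) → e ∷ ds , refl , p })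
         (λ { (e ∷ ds , refl , p) → e , ds , refl , p })
         (anyEdge? λ e → anyEdgeList? k λ ds → P? (e ∷ ds))

  balancedByDeleting? : (σ : Signature G) → ∀ k → Dec (BalancedByDeleting σ k)
  balancedByDeleting? σ k =
    map′ (λ (ds , l , u , b) → ds , u , l , b) (λ (ds , u , l , b) → ds , l , u , b)
         (anyEdgeList? k λ ds →
            allPairs? (λ e f → ¬? (joins? e (src f) (tgt f))) ds ×-dec balanced? (restrict σ ds))

module _ {m : ℕ} (G : Graph m) where

  open SetoidMembership (edgeSetoid G) using (_∈_)

  private
    fromPair : Fin m → Fin m → List (Edge G)
    fromPair u v with T? (Graph.adj G u v)
    ... | yes p = edge u v p ∷ []
    ... | no  _ = []

    fromPair-complete : ∀ u v (p : Adj G u v) → edge u v p ∈ₚ fromPair u v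
    fromPair-complete u v p with T? (Graph.adj G u v)
    ... | yes q = here (cong (edge u v) (T-irrelevant p q))
    ... | no ¬p = ⊥-elim (¬p p)

    orientedEdges : List (Edge G)
    orientedEdges = concatMap (λ u → concatMap (fromPair u) (allFin m)) (allFin m)

    oriented-complete : ∀ e → e ∈ₚ orientedEdges
    oriented-complete (edge u v p) =
      ∈-concatMap⁺ _ {xs = allFin m} (Any.map (λ { refl →
        ∈-concatMap⁺ (fromPair u) {xs = allFin m}
          (Any.map (λ { refl → fromPair-complete u v p }) (∈-allFin v)) })
        (∈-allFin u))

  allEdges : List (Edge G)
  allEdges = deduplicate (DecSetoid._≟_ (edgeDecSetoid G)) orientedEdges

  allEdges-distinct : DistinctEdges allEdges
  allEdges-distinct = UniqueDecSetoid.deduplicate-! (edgeDecSetoid G) orientedEdges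

  allEdges-complete : ∀ e → e ∈ allEdges
  allEdges-complete e =
    SetoidMembershipₚ.∈-deduplicate⁺ (edgeSetoid G) (DecSetoid._≟_ (edgeDecSetoid G))
      (λ {c} {d} {f} f≈d c≈d → ≈ᴱ-trans {e = c} {f = d} {g = f} c≈d (≈ᴱ-sym {e = f} {f = d} f≈d))
      {xs = orientedEdges} {z = e}
      (Any.map (λ { refl → inj₁ (refl , refl) }) (oriented-complete e))


module _ {m : ℕ} {G : Graph m} where

  deleteAll-balanced : (σ : Signature G) → Balanced (restrict σ (allEdges G))
  deleteAll-balanced σ (cycle u (_∷_ {v = v} p _) _ _) =
    ⊥-elim (toWitnessFalse {a? = deleted? G (allEdges G) u v} notDeleted
      (Any.map (λ {e} → ≈ᴱ-sym {e = edge u v arc} {f = e}) (allEdges-complete G (edge u v arc))))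
    where
    arc : Adj G u v
    arc = delete-⊆ G (allEdges G) p

    notDeleted : T (not ⌊ deleted? G (allEdges G) u v ⌋)
    notDeleted = proj₂ (Equivalence.to T-∧ p)

  deleteAll : (σ : Signature G) → BalancedByDeleting σ (length (allEdges G))
  deleteAll σ = allEdges G , allEdges-distinct G , refl , deleteAll-balanced σ

  -- Abstract so that frustrationIndex σ does not unfold into the search;
  -- frustrationIndex-least determines it.
  abstract
    frustrationIndex-exists : (σ : Signature G) → ∃ (Least (BalancedByDeleting σ))
    frustrationIndex-exists σ =
      least (BalancedByDeleting σ) (balancedByDeleting? σ) (length (allEdges G)) (deleteAll σ)

  frustrationIndex : Signature G → ℕ
  frustrationIndex σ = proj₁ (frustrationIndex-exists σ)

  frustrationIndex-least : (σ : Signature G) → Least (BalancedByDeleting σ) (frustrationIndex σ)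
  frustrationIndex-least σ = proj₂ (frustrationIndex-exists σ)

walkSign-cong : {m : ℕ} {G : Graph m} {σ τ : Signature G} → σ ≈ˢ τ →
                ∀ {u w} (c : Walk G u w) → walkSign σ c ≡ walkSign τ c
walkSign-cong eq []      = refl
walkSign-cong {σ = σ} {τ} eq (p ∷ c) =
  cong₂ _*_ (eq _ _ p) (walkSign-cong {σ = σ} {τ} eq c)

frustrationIndex-cong-≤ : {m : ℕ} {G : Graph m} (σ τ : Signature G) → σ ≈ˢ τ →
                          frustrationIndex σ ≤ frustrationIndex τ
frustrationIndex-cong-≤ {G = G} σ τ eq with proj₁ (frustrationIndex-least τ)
... | ds , u , len , bal = proj₂ (frustrationIndex-least σ) (frustrationIndex τ) (ds , u , len , λ c →
  trans (walkSign-cong {σ = restrict σ ds} {τ = restrict τ ds}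
           (λ v w p → eq v w (delete-⊆ G ds p)) (walk c)) (bal c))

frustrationIndex-cong : {m : ℕ} {G : Graph m} (σ τ : Signature G) → σ ≈ˢ τ →
                        frustrationIndex σ ≡ frustrationIndex τ
frustrationIndex-cong σ τ eq =
  ℕ.≤-antisym (frustrationIndex-cong-≤ σ τ eq) (frustrationIndex-cong-≤ τ σ λ u v p → sym (eq u v p))

module _ {m : ℕ} (G : Graph m) where

  private
    bit : Bool → Sign
    bit true  = neg
    bit false = pos

    isNeg : Sign → Bool
    isNeg neg = true
    isNeg pos = false

    bit-isNeg : ∀ s → bit (isNeg s) ≡ s
    bit-isNeg neg = refl
    bit-isNeg pos = refl

    -- Subsets of Fin m × Fin m enumerate the signatures up to _≈ˢ_.
    decode : Subset (m ℕ.* m) → Signature G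
    decode t = record
      { sgn     = λ u v _ → entry u v * entry v u
      ; sgn-sym = λ u v _ _ → Sign.*-comm (entry u v) (entry v u)
      }
      where
      entry : Fin m → Fin m → Sign
      entry u v = bit (lookup t (combine u v))

    module _ (σ : Signature G) where

      upper : Fin m → Fin m → Bool
      upper u v with u Fin.<? v | T? (Graph.adj G u v)
      ... | yes _ | yes p = isNeg (sgn σ u v p)
      ... | _     | _     = false

      upper-< : ∀ {u v} → toℕ u < toℕ v → ∀ p → bit (upper u v) ≡ sgn σ u v p
      upper-< {u} {v} u<v p with u Fin.<? v | T? (Graph.adj G u v)
      ... | no u≮v | _     = ⊥-elim (u≮v u<v)
      ... | yes _  | no ¬p = ⊥-elim (¬p p)
      ... | yes _  | yes q = trans (bit-isNeg _) (cong (sgn σ u v) (T-irrelevant q p))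

      upper-≮ : ∀ {u v} → ¬ toℕ u < toℕ v → bit (upper u v) ≡ pos
      upper-≮ {u} {v} u≮v with u Fin.<? v | T? (Graph.adj G u v)
      ... | no _    | _ = refl
      ... | yes u<v | _ = ⊥-elim (u≮v u<v)

      encode : Subset (m ℕ.* m)
      encode = tabulate (uncurry upper ∘ remQuot m)

      lookup-encode : ∀ u v → lookup encode (combine u v) ≡ upper u v
      lookup-encode u v = trans (lookup∘tabulate _ (combine u v))
                                (cong (uncurry upper) (Fin.remQuot-combine u v))

      decode-encode : decode encode ≈ˢ σ
      decode-encode u v p rewrite lookup-encode u v | lookup-encode v u with Fin.<-cmp u v
      ... | tri< u<v _ v≮u = trans (cong₂ _*_ (upper-< u<v p) (upper-≮ v≮u)) (Sign.*-identityʳ _)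
      ... | tri≈ _ refl _  = ⊥-elim (Graph.adj-irrefl G u p)
      ... | tri> u≮v _ v<u =
        trans (cong₂ _*_ (upper-≮ u≮v) (upper-< v<u q)) (sgn-sym σ v u q p)
        where
        q : Adj G v u
        q = Graph.adj-sym G u v p

  Attained : ℕ → Set
  Attained k = Σ (Signature G) λ σ → frustrationIndex σ ≡ k

  attained? : ∀ k → Dec (Attained k)
  attained? k =
    map′ (λ (t , eq) → decode t , eq)
         (λ (σ , eq) → encode σ ,
            trans (frustrationIndex-cong (decode (encode σ)) σ (decode-encode σ)) eq)
         (anySubset? λ t → frustrationIndex (decode t) ℕ.≟ k)

  frustrationIndex-bounded : ∀ k → Attained k → k ≤ length (allEdges G)
  frustrationIndex-bounded _ (σ , refl) = proj₂ (frustrationIndex-least σ) _ (deleteAll σ)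

  abstract
    maximum-exists : ∃ (Greatest Attained)
    maximum-exists = greatest Attained attained? (length (allEdges G)) frustrationIndex-bounded
                       (_ , allNegative G , refl)

  maxFrustrationIndex : ℕ
  maxFrustrationIndex = proj₁ maximum-exists

  maxFrustrationIndex-greatest : Greatest Attained maxFrustrationIndex
  maxFrustrationIndex-greatest = proj₂ maximum-exists

complete : (m : ℕ) → Graph m
complete m = record
  { adj        = λ u v → not ⌊ u Fin.≟ v ⌋
  ; adj-sym    = λ u v p → fromWitnessFalse {a? = v Fin.≟ u}
                             (toWitnessFalse {a? = u Fin.≟ v} p ∘ sym)
  ; adj-irrefl = λ u p → toWitnessFalse {a? = u Fin.≟ u} p refl
  }

-- j is the cyclic successor of i in Fin n.
Next : {n : ℕ} → Fin n → Fin n → Set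
Next {n} i j = toℕ j ≡ suc (toℕ i) ⊎ (suc (toℕ i) ≡ n × toℕ j ≡ 0)

next? : ∀ {n} (i j : Fin n) → Dec (Next i j)
next? {n} i j = toℕ j ℕ.≟ suc (toℕ i) ⊎-dec (suc (toℕ i) ℕ.≟ n ×-dec toℕ j ℕ.≟ 0)

cyclicAdj? : ∀ {n} (i j : Fin n) → Dec (Next i j ⊎ Next j i)
cyclicAdj? i j = next? i j ⊎-dec next? j i

cycleGraph : (n : ℕ) → 3 ≤ n → Graph n
cycleGraph n n≥3 = record
  { adj        = λ i j → ⌊ cyclicAdj? i j ⌋
  ; adj-sym    = λ i j p → fromWitness {a? = cyclicAdj? j i}
                             (swap (toWitness {a? = cyclicAdj? i j} p))
  ; adj-irrefl = λ i p → irrefl i (toWitness {a? = cyclicAdj? i i} p)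
  }
  where
  next-irrefl : (i : Fin n) → ¬ Next i i
  next-irrefl i (inj₁ eq)         = ℕ.1+n≢n (sym eq)
  next-irrefl i (inj₂ (eq , i≡0)) =
    ℕ.<⇒≱ (s≤s (s≤s z≤n)) (subst (3 ≤_) (trans (sym eq) (cong suc i≡0)) n≥3)

  irrefl : (i : Fin n) → ¬ (Next i i ⊎ Next i i)
  irrefl i (inj₁ p) = next-irrefl i p
  irrefl i (inj₂ p) = next-irrefl i p

infixr 5 _∨ᴳ_

_∨ᴳ_ : {a b : ℕ} → Graph a → Graph b → Graph (a + b)
_∨ᴳ_ {a} {b} G H = record
  { adj        = λ u v → joinAdj (splitAt a u) (splitAt a v)
  ; adj-sym    = λ u v → joinAdj-sym (splitAt a u) (splitAt a v)
  ; adj-irrefl = λ u → joinAdj-irrefl (splitAt a u)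
  }
  where
  joinAdj : Fin a ⊎ Fin b → Fin a ⊎ Fin b → Bool
  joinAdj (inj₁ u) (inj₁ v) = Graph.adj G u v
  joinAdj (inj₂ u) (inj₂ v) = Graph.adj H u v
  joinAdj (inj₁ _) (inj₂ _) = true
  joinAdj (inj₂ _) (inj₁ _) = true

  joinAdj-sym : ∀ x y → T (joinAdj x y) → T (joinAdj y x)
  joinAdj-sym (inj₁ u) (inj₁ v) = Graph.adj-sym G u v
  joinAdj-sym (inj₂ u) (inj₂ v) = Graph.adj-sym H u v
  joinAdj-sym (inj₁ _) (inj₂ _) = λ p → p
  joinAdj-sym (inj₂ _) (inj₁ _) = λ p → p

  joinAdj-irrefl : ∀ x → ¬ T (joinAdj x x)
  joinAdj-irrefl (inj₁ u) = Graph.adj-irrefl G u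
  joinAdj-irrefl (inj₂ u) = Graph.adj-irrefl H u

wheel : (n : ℕ) → 3 ≤ n → Graph (1 + n)
wheel n n≥3 = complete 1 ∨ᴳ cycleGraph n n≥3

{-# OPTIONS --safe #-}
module Submission where

-- For a function f from the vertices to the signs, deleting the edges uv whose
-- sign differs from f u * f v balances a signed graph.  On the wheel take f = +
-- at the hub and f i = (sign of the i-th spoke) * x i: the deleted edges are the
-- spokes with x i = - and the rim edges with t i * x i * x (i+1) = -, where t i
-- is the sign of the triangle on the i-th rim edge, so only t matters.  An even
-- stretch of 2r triangles costs at most r, and a positive triangle costs nothing
-- when x = + at both its ends.  Hence ⌈n/2⌉ deletions always suffice, and fewer
-- do if n is odd and some triangle is positive, or if n is even and there are
-- positive triangles both at an even and at an odd position.  Conversely every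
-- edge meets at most two of the n triangles, and edge-disjoint negative triangles
-- need distinct deletions.

open import Defs
open import Data.Bool.Base using (Bool; true; false; _xor_; if_then_else_)
open import Data.Bool.Properties using (T-∧; T-irrelevant; xor-comm)
open import Data.Empty using (⊥-elim)
open import Data.Fin.Base using (Fin; zero; suc; toℕ; fromℕ<; combine)
import Data.Fin.Properties as Fin
open import Data.List.Base
  using (List; []; _∷_; [_]; _++_; length; concat; applyUpTo; deduplicate; lookup)
open import Data.List.Properties using (length-++; length-deduplicate)
open import Data.List.Relation.Unary.All using (All; []; _∷_)
import Data.List.Relation.Unary.All as All
open import Data.List.Relation.Unary.All.Properties using (¬Any⇒All¬)
open import Data.List.Relation.Unary.AllPairs using ([]; _∷_)
open import Data.List.Relation.Unary.Any using (Any; here; there; index)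
import Data.List.Relation.Unary.Any as Any
import Data.List.Relation.Unary.Any.Properties as Any
open import Data.List.Relation.Unary.Unique.Propositional using (Unique)
import Data.List.Relation.Unary.Unique.DecSetoid.Properties as UniqueDecSetoid
open import Data.Nat.Base
  using (ℕ; zero; suc; _+_; _≤_; _<_; z≤n; s≤s; ⌊_/2⌋; ⌈_/2⌉)
import Data.Nat.Base as ℕ using (_*_)
open import Data.Nat.ListAction using (sum)
open import Data.Nat.Divisibility using (_∣_; divides)
import Data.Nat.Properties as ℕ
open import Data.Nat.Tactic.RingSolver using (solve-∀)
open import Data.Product using (Σ; ∃; ∃-syntax; _×_; _,_; proj₁; proj₂)
open import Data.Sign.Base using (Sign; _*_) renaming (+ to pos; - to neg)
import Data.Sign.Properties as Sign
open import Data.Sum.Base using (_⊎_; inj₁; inj₂; swap; [_,_]′)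
open import Data.Unit.Base using (tt)
import Data.Vec.Base as Vec
open import Data.Vec.Properties using (lookup∘tabulate)
open import Function.Base using (_∘_)
open import Function.Bundles using (_⇔_; mk⇔; Equivalence)
open import Relation.Binary.Bundles using (DecSetoid)
open import Relation.Binary.PropositionalEquality
  using (_≡_; _≢_; refl; sym; trans; cong; cong₂; subst)
open import Relation.Nullary using (¬_; Dec; yes; no)
open import Relation.Nullary.Decidable
  using (map′; _×-dec_; _→-dec_; toWitness; fromWitness; toWitnessFalse; fromWitnessFalse)

forallSigns? : {P : Sign → Set} → (∀ s → Dec (P s)) → Dec (∀ s → P s)
forallSigns? P? = map′ (λ { (p , q) pos → p ; (p , q) neg → q }) (λ f → f pos , f neg)
                       (P? pos ×-dec P? neg)

-- Frustration index from potentials and from disjoint negative cycles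

module _ {m : ℕ} {G : Graph m} where

  -- Each inner vertex contributes the square of its sign, so the product telescopes; in particular
  -- closed walks are positive.
  walkSign-potential : (σ : Signature G) (f : Fin m → Sign) →
                       (∀ u v p → sgn σ u v p ≡ f u * f v) →
                       ∀ {u w} (c : Walk G u w) → walkSign σ c ≡ f u * f w
  walkSign-potential σ f eq {u} []      = sym (Sign.s*s≡+ (f u))
  walkSign-potential σ f eq (_∷_ {u} {v} {w} p c) =
    trans (cong₂ _*_ (eq u v p) (walkSign-potential σ f eq c)) (telescope (f u) (f v) (f w))
    where
    telescope : ∀ a b c → (a * b) * (b * c) ≡ a * c
    telescope = toWitness {a? = forallSigns? λ a → forallSigns? λ b → forallSigns? λ c →
                                (a * b) * (b * c) Sign.≟ a * c} tt

module _ {m : ℕ} {G : Graph m} where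

  -- Every edge surviving the deletion has a product of potentials as its sign. Since `es` may
  -- repeat an edge or list it in both orientations, it is deduplicated first, which only shortens
  -- it.
  frustrationIndex≤length : (σ : Signature G) (f : Fin m → Sign) (es : List (Edge G)) →
                            (∀ u v p → Deleted G es u v ⊎ sgn σ u v p ≡ f u * f v) →
                            frustrationIndex σ ≤ length es
  frustrationIndex≤length σ f es satisfied =
    ℕ.≤-trans (proj₂ (frustrationIndex-least σ) (length ds)
                (ds , UniqueDecSetoid.deduplicate-! (edgeDecSetoid G) es , refl , balanced))
              (length-deduplicate ≟ᴱ es)
    where
    ≟ᴱ = DecSetoid._≟_ (edgeDecSetoid G)
    ds = deduplicate ≟ᴱ es

    deleted : ∀ {u v} → Adj G u v → Deleted G es u v → Deleted G ds u v
    deleted {u} {v} p = Any.deduplicate⁺ ≟ᴱ λ {e} {f} f≈e e∋uv →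
      ≈ᴱ-trans {e = f} {f = e} {g = edge u v p} f≈e e∋uv

    sign-kept : ∀ u v p → sgn (restrict σ ds) u v p ≡ f u * f v
    sign-kept u v p with satisfied u v (delete-⊆ G ds p)
    ... | inj₂ eq = eq
    ... | inj₁ d  = ⊥-elim (toWitnessFalse {a? = deleted? G ds u v}
                      (proj₂ (Equivalence.to T-∧ p)) (deleted (delete-⊆ G ds p) d))

    balanced : Balanced (restrict σ ds)
    balanced (cycle b w _ _) = trans (walkSign-potential (restrict σ ds) f sign-kept w) (Sign.s*s≡+ (f b))

  Avoids : List (Edge G) → Edge G → Set
  Avoids ds e = ¬ Deleted G ds (src e) (tgt e)

  -- Carries a cycle over to the graph after deletion: equal length and vertex list keep it a cycle,
  -- and its sign is unchanged.
  walk-delete : (σ : Signature G) (ds : List (Edge G)) →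
                ∀ {u w} (c : Walk G u w) → All (Avoids ds) (edges c) →
                Σ (Walk (delete G ds) u w) λ c′ → walkLength c′ ≡ walkLength c ×
                  vertices c′ ≡ vertices c × walkSign (restrict σ ds) c′ ≡ walkSign σ c
  walk-delete σ ds []      _          = [] , refl , refl , refl
  walk-delete σ ds (_∷_ {u} {v} p c) (avoids ∷ rest) with walk-delete σ ds c rest
  ... | c′ , len , verts , sign =
    p′ ∷ c′ , cong suc len , cong (u ∷_) verts ,
    cong₂ _*_ (cong (sgn σ u v) (T-irrelevant _ p)) sign
    where
    p′ : Adj (delete G ds) u v
    p′ = Equivalence.from T-∧ (p , fromWitnessFalse {a? = deleted? G ds u v} avoids)

  -- A cycle missing every deleted edge would survive as a negative cycle, against balance.
  negativeCycle-hit : (σ : Signature G) (ds : List (Edge G)) → Balanced (restrict σ ds) →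
                      (c : Cycle G) → cycleSign σ c ≡ neg →
                      Any (λ e → Deleted G ds (src e) (tgt e)) (cycleEdges c)
  negativeCycle-hit σ ds balanced c@(cycle b w l d) negative
    with Any.any? (λ e → deleted? G ds (src e) (tgt e)) (edges w)
  ... | yes hit = hit
  ... | no ¬hit with walk-delete σ ds w (¬Any⇒All¬ _ ¬hit)
  ...   | w′ , len , verts , sign
    with () ← trans (sym (balanced (cycle b w′ (subst (3 ≤_) (sym len) l)
                                     (subst Unique (sym verts) d))))
                    (trans sign negative)

  -- Each triangle is sent to the index of a deleted edge it contains; two triangles with the same
  -- index would share that edge.
  disjointNegativeTriangles-≤ : (σ : Signature G) → ∀ k → DisjointNegativeTriangles σ k →
                                k ≤ frustrationIndex σ
  disjointNegativeTriangles-≤ σ k (t , disjoint) with proj₁ (frustrationIndex-least σ)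
  ... | ds , _ , len , balanced = subst (k ≤_) len (Fin.injective⇒≤ hitIndex-injective)
    where
    hit : ∀ i → Any (λ e → Deleted G ds (src e) (tgt e)) (cycleEdges (proj₁ (t i)))
    hit i = negativeCycle-hit σ ds balanced (proj₁ (t i)) (proj₂ (proj₂ (t i)))

    hitIndex : Fin k → Fin (length ds)
    hitIndex i = index (proj₂ (Any.satisfied (hit i)))

    deletedHit : ∀ {es} (a : Any (λ e → Deleted G ds (src e) (tgt e)) es) →
                 Any (lookup ds (index (proj₂ (Any.satisfied a))) ≈ᴱ_) es
    deletedHit (here d)  = here (Any.lookup-index d)
    deletedHit (there a) = there (deletedHit a)

    common : ∀ (d : Edge G) {es fs} → Any (d ≈ᴱ_) es → Any (d ≈ᴱ_) fs →
             ¬ All (λ e → All (λ f → ¬ e ≈ᴱ f) fs) es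
    common d d∈es d∈fs apart with All.lookupAny apart d∈es
    ... | apart-e , d≈e with All.lookupAny apart-e d∈fs
    ...   | e≉f , d≈f = e≉f (≈ᴱ-trans {e = Any.lookup d∈es} {f = d} {g = Any.lookup d∈fs}
                               (≈ᴱ-sym {e = d} {f = Any.lookup d∈es} d≈e) d≈f)

    hitIndex-injective : ∀ {i j} → hitIndex i ≡ hitIndex j → i ≡ j
    hitIndex-injective {i} {j} eq with i Fin.≟ j
    ... | yes i≡j = i≡j
    ... | no i≢j  = ⊥-elim (common (lookup ds (hitIndex i)) (deletedHit (hit i))
      (subst (λ d → Any (lookup ds d ≈ᴱ_) (cycleEdges (proj₁ (t j)))) (sym eq) (deletedHit (hit j)))
      (disjoint i j i≢j))

-- Labellings of the rim

penalty : Sign → ℕ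
penalty pos = 0
penalty neg = 1

-- The vertex x i counts for its deleted spoke, the triangle between x i and
-- x (suc i) for its deleted rim edge.
cost : (t x : ℕ → Sign) → ℕ → ℕ
cost t x n = sum (applyUpTo (λ i → penalty (x i) + penalty (t i * (x i * x (suc i)))) n)

-- The end labels are indices so that stretches can be glued. `cost` charges the spoke at position 0
-- but not at position `n`, so gluing, or closing up when `a` equals `e`, counts every spoke once.
record Labelling (t : ℕ → Sign) (n : ℕ) (a e : Sign) (c : ℕ) : Set where
  field
    label : ℕ → Sign
    start : label 0 ≡ a
    end   : label n ≡ e
    cheap : cost t label n ≤ c

open Labelling

module _ {t : ℕ → Sign} where

  stop : ∀ {a} → Labelling t 0 a a 0
  stop {a} = record { label = λ _ → a ; start = refl ; end = refl ; cheap = z≤n }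

  step : ∀ {n b e c} a → Labelling (t ∘ suc) n b e c →
         Labelling t (suc n) a e (penalty a + penalty (t 0 * (a * b)) + c)
  step {n} {c = c} a L = record
    { label = x
    ; start = refl
    ; end   = end L
    ; cheap = subst (λ b → cost t x (suc n) ≤ penalty a + penalty (t 0 * (a * b)) + c) (start L)
                (ℕ.+-monoʳ-≤ (penalty a + penalty (t 0 * (a * label L 0))) (cheap L))
    }
    where
    x : ℕ → Sign
    x zero    = a
    x (suc i) = label L i

  relax : ∀ {n a e c d} → c ≤ d → Labelling t n a e c → Labelling t n a e d
  relax c≤d L = record
    { label = label L ; start = start L ; end = end L ; cheap = ℕ.≤-trans (cheap L) c≤d }

  -- If the triangle sign is the product of the end labels, the rim edge is kept and only the spoke
  -- labelled `a` is charged.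
  step-free : ∀ {n b e c} a → t 0 ≡ a * b → Labelling (t ∘ suc) n b e c →
              Labelling t (suc n) a e (penalty a + c)
  step-free {b = b} {c = c} a eq = relax (ℕ.≤-reflexive (cong (_+ c) free)) ∘ step a
    where
    free : penalty a + penalty (t 0 * (a * b)) ≡ penalty a
    free rewrite eq = trans (cong (λ s → penalty a + penalty s) (Sign.s*s≡+ (a * b)))
                            (ℕ.+-identityʳ _)

  -- With + at both ends the new triangle charges no spoke, and at worst its rim edge.
  skip : ∀ {n e c} → Labelling (t ∘ suc) n pos e c → Labelling t (suc n) pos e (suc c)
  skip {c = c} = relax (ℕ.+-monoˡ-≤ c (penalty≤1 (t 0))) ∘ step pos
    where
    penalty≤1 : ∀ s → penalty (s * pos) ≤ 1
    penalty≤1 pos = z≤n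
    penalty≤1 neg = s≤s z≤n

-- Two consecutive negative triangles are both repaired by their common
-- spoke; otherwise at most one rim edge needs repair.
pair : ∀ {t n e c} → Labelling (λ i → t (2 + i)) n pos e c →
       Labelling t (suc (suc n)) pos e (suc c)
pair {t} L with t 0 in eq₀ | t 1 in eq₁
... | pos | _   = step-free pos eq₀ (skip L)
... | neg | pos = skip (step-free pos eq₁ L)
... | neg | neg = step-free pos eq₀ (step-free neg eq₁ L)

pairs : ∀ {t m e c} r → Labelling (λ i → t (r ℕ.* 2 + i)) m pos e c →
        Labelling t (r ℕ.* 2 + m) pos e (r + c)
pairs     zero    L = L
pairs {t} (suc r) L = pair (pairs {λ i → t (2 + i)} r L)

recast : ∀ {t m n a e c d} → m ≡ n → c ≡ d → Labelling t m a e c → Labelling t n a e d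
recast refl refl L = L

-- Cheap labellings of the closed rim, by the parity of its length.

Closed : (ℕ → Sign) → ℕ → ℕ → Set
Closed t n c = ∃[ a ] Labelling t n a a c

data Parity : ℕ → Set where
  even : ∀ k → Parity (k ℕ.* 2)
  odd  : ∀ k → Parity (suc (k ℕ.* 2))

parity : ∀ n → Parity n
parity zero    = even 0
parity (suc n) with parity n
... | even k = odd k
... | odd k  = even (suc k)

closed-even : ∀ t k → Closed t (k ℕ.* 2) k
closed-even t k = pos , recast (ℕ.+-identityʳ _) (ℕ.+-identityʳ _) (pairs {t} k stop)

closed-odd : ∀ t k → Closed t (suc (k ℕ.* 2)) (suc k)
closed-odd t k = pos , skip (proj₂ (closed-even (t ∘ suc) k))

-- Each multiple of 2 is a stretch treated by `pairs`, each `suc` a single free triangle; a final 1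
-- is the last triangle of a labelling that starts and ends with `neg`. The same identities locate
-- these single triangles.
stretch₂ : ∀ p s → p ℕ.* 2 + suc (s ℕ.* 2 + 0) ≡ suc ((p + s) ℕ.* 2)
stretch₂ = solve-∀

stretch₂-+1 : ∀ p s → p ℕ.* 2 + suc (s ℕ.* 2 + 1) ≡ suc (suc ((p + s) ℕ.* 2))
stretch₂-+1 = solve-∀

stretch₃ : ∀ p s r → p ℕ.* 2 + suc (s ℕ.* 2 + suc (r ℕ.* 2 + 0)) ≡
                     suc (suc ((p + s + r) ℕ.* 2))
stretch₃ = solve-∀

stretch₃-+1 : ∀ p s r → p ℕ.* 2 + suc (s ℕ.* 2 + suc (r ℕ.* 2 + 1)) ≡
                        suc (suc (suc ((p + s + r) ℕ.* 2)))
stretch₃-+1 = solve-∀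

total₂ : ∀ p s → p + (s + 0) ≡ p + s
total₂ = solve-∀

total₃ : ∀ p s r → p + (s + (r + 0)) ≡ p + s + r
total₃ = solve-∀

-- The positive triangle at an even position splits off for free, leaving
-- even stretches on both sides.
closed-odd-< : ∀ t k p → p ≤ k → t (p ℕ.* 2) ≡ pos → Closed t (suc (k ℕ.* 2)) k
closed-odd-< t k p p≤k tₚ with ℕ.m≤n⇒∃[o]m+o≡n p≤k
... | s , refl = pos , recast (stretch₂ p s) (total₂ p s)
  (pairs {t} p (step-free pos (trans (cong t (ℕ.+-identityʳ _)) tₚ)
    (pairs {λ i → t (p ℕ.* 2 + suc i)} s stop)))

-- At an odd position, x 0 = - repairs the first and the last triangle at the cost
-- of one spoke, unless one of these (at an even position) is positive itself.
closed-odd-positive : ∀ t k j → j < suc (k ℕ.* 2) → t j ≡ pos → Closed t (suc (k ℕ.* 2)) k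
closed-odd-positive t k j j<n tⱼ with parity j
... | even p = closed-odd-< t k p (ℕ.*-cancelʳ-≤ p k 2 (ℕ.≤-pred j<n)) tⱼ
... | odd p with t 0 in t₀ | t (k ℕ.* 2) in tₗ
...   | pos | _   = closed-odd-< t k 0 z≤n t₀
...   | neg | pos = closed-odd-< t k k ℕ.≤-refl tₗ
...   | neg | neg with ℕ.m≤n⇒∃[o]m+o≡n (ℕ.*-cancelʳ-< 2 p k (ℕ.≤-pred j<n))
...     | s , refl = neg , recast (cong suc (stretch₂-+1 p s)) (cong suc (total₂ p s))
  (step-free {t} neg t₀ (pairs {t ∘ suc} p (step-free pos (trans (cong t (ℕ.+-identityʳ _)) tⱼ)
    (pairs {λ i → t (suc (p ℕ.* 2 + suc i))} s
      (step-free pos (trans (cong t (cong suc (stretch₂ p s))) tₗ) stop)))))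

-- With the even position first, the two positive triangles are free between labels +, and the other
-- `k * 2` triangles form three even stretches.
closed-even-≤ : ∀ t k p q → p ≤ q → q ≤ k → t (p ℕ.* 2) ≡ pos → t (suc (q ℕ.* 2)) ≡ pos →
                Closed t (suc k ℕ.* 2) k
closed-even-≤ t k p q p≤q q≤k tₚ tq with ℕ.m≤n⇒∃[o]m+o≡n p≤q | ℕ.m≤n⇒∃[o]m+o≡n q≤k
... | s , refl | r , refl = pos , recast (stretch₃ p s r) (total₃ p s r)
  (pairs {t} p (step-free pos (trans (cong t (ℕ.+-identityʳ _)) tₚ)
    (pairs {λ i → t (p ℕ.* 2 + suc i)} s (step-free pos (trans (cong t (stretch₂ p s)) tq)
      (pairs {λ i → t (p ℕ.* 2 + suc (s ℕ.* 2 + suc i))} r stop)))))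

-- If the odd position comes first, a positive first or last triangle restores the order of
-- `closed-even-≤`. Otherwise both are negative, and the label - at position 0 repairs them with one
-- spoke.
closed-even-positive : ∀ t k p q → p ≤ k → q ≤ k →
                       t (p ℕ.* 2) ≡ pos → t (suc (q ℕ.* 2)) ≡ pos → Closed t (suc k ℕ.* 2) k
closed-even-positive t k p q p≤k q≤k tₚ tq with p ℕ.≤? q
... | yes p≤q = closed-even-≤ t k p q p≤q q≤k tₚ tq
... | no p≰q with t 0 in t₀ | t (suc (k ℕ.* 2)) in tₗ
...   | pos | _   = closed-even-≤ t k 0 q z≤n q≤k t₀ tq
...   | neg | pos = closed-even-≤ t k p k p≤k ℕ.≤-refl tₚ tₗ
...   | neg | neg with ℕ.m≤n⇒∃[o]m+o≡n (ℕ.≰⇒> p≰q)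
...     | s , refl with ℕ.m≤n⇒∃[o]m+o≡n p≤k
-- Here `p` is `suc q + s` and `k` is `suc q + s + r`: one spoke at position 0 and `q + s + r` pairs
-- cost exactly `k`.
...       | r , refl = neg , recast (cong suc (stretch₃-+1 q s r)) (cong suc (total₃ q s r))
  (step-free {t} neg t₀ (pairs {t ∘ suc} q (step-free pos (trans (cong t (ℕ.+-identityʳ _)) tq)
    (pairs {λ i → t (suc (q ℕ.* 2 + suc i))} s (step-free pos (trans (cong t (cong suc (stretch₂ q s))) tₚ)
      (pairs {λ i → t (suc (q ℕ.* 2 + suc (s ℕ.* 2 + suc i)))} r
        (step-free pos (trans (cong t (cong suc (stretch₃ q s r))) tₗ) stop)))))))

all-negative? : ∀ k (t : ℕ → Sign) →
                (∀ (i : Fin k) → t (toℕ i) ≡ neg) ⊎ ∃[ j ] (j < k × t j ≡ pos)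
all-negative? zero    t = inj₁ λ ()
all-negative? (suc k) t with t 0 in t₀ | all-negative? k (t ∘ suc)
... | pos | _                     = inj₂ (0 , s≤s z≤n , t₀)
... | neg | inj₁ negative         = inj₁ λ { zero → t₀ ; (suc i) → negative i }
... | neg | inj₂ (j , j<k , tⱼ) = inj₂ (suc j , s≤s j<k , tⱼ)

alternating-or-closed : ∀ t k → (∀ (i : Fin (suc k)) → t (toℕ i ℕ.* 2) ≡ neg) ⊎
                        (∀ (i : Fin (suc k)) → t (suc (toℕ i ℕ.* 2)) ≡ neg) ⊎
                        Closed t (suc k ℕ.* 2) k
alternating-or-closed t k
  with all-negative? (suc k) (λ i → t (i ℕ.* 2)) | all-negative? (suc k) (λ i → t (suc (i ℕ.* 2)))
... | inj₁ negative       | _                   = inj₁ negative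
... | inj₂ _              | inj₁ negative       = inj₂ (inj₁ negative)
... | inj₂ (p , p≤k , tₚ) | inj₂ (q , q≤k , tq) =
  inj₂ (inj₂ (closed-even-positive t k p q (ℕ.≤-pred p≤k) (ℕ.≤-pred q≤k) tₚ tq))

-- The wheel

module _ {n : ℕ} where

  next-functional : ∀ {i j k : Fin n} → Next i j → Next i k → j ≡ k
  next-functional (inj₁ p) (inj₁ q) = Fin.toℕ-injective (trans p (sym q))
  next-functional {j = j} (inj₁ p) (inj₂ (q , _)) =
    ⊥-elim (ℕ.<⇒≢ (Fin.toℕ<n j) (trans p q))
  next-functional {k = k} (inj₂ (p , _)) (inj₁ q) =
    ⊥-elim (ℕ.<⇒≢ (Fin.toℕ<n k) (trans q p))
  next-functional (inj₂ (_ , p)) (inj₂ (_ , q)) = Fin.toℕ-injective (trans p (sym q))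

  next-injective : ∀ {i j k : Fin n} → Next i k → Next j k → i ≡ j
  next-injective (inj₁ p) (inj₁ q) = Fin.toℕ-injective (ℕ.suc-injective (trans (sym p) q))
  next-injective (inj₁ p) (inj₂ (_ , q)) with () ← trans (sym p) q
  next-injective (inj₂ (_ , p)) (inj₁ q) with () ← trans (sym q) p
  next-injective (inj₂ (p , _)) (inj₂ (q , _)) =
    Fin.toℕ-injective (ℕ.suc-injective (trans p (sym q)))

  successor : (i : Fin n) → ∃ (Next i)
  successor i with suc (toℕ i) ℕ.<? n
  ... | yes i+1<n = fromℕ< i+1<n , inj₁ (Fin.toℕ-fromℕ< i+1<n)
  ... | no  i+1≮n = fromℕ< 0<n , inj₂ (ℕ.≤-antisym (Fin.toℕ<n i) (ℕ.≮⇒≥ i+1≮n) , Fin.toℕ-fromℕ< 0<n)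
    where
    0<n : 0 < n
    0<n = ℕ.≤-<-trans z≤n (Fin.toℕ<n i)

length-concat-applyUpTo : ∀ {A : Set} {g : ℕ → List A} {h : ℕ → ℕ} →
                          (∀ k → length (g k) ≡ h k) →
                          ∀ n → length (concat (applyUpTo g n)) ≡ sum (applyUpTo h n)
length-concat-applyUpTo         eq zero    = refl
length-concat-applyUpTo {g = g} eq (suc n) =
  trans (length-++ (g 0)) (cong₂ _+_ (eq 0) (length-concat-applyUpTo (eq ∘ suc) n))

⌊k*2/2⌋ : ∀ k → ⌊ k ℕ.* 2 /2⌋ ≡ k
⌊k*2/2⌋ zero    = refl
⌊k*2/2⌋ (suc k) = cong suc (⌊k*2/2⌋ k)

⌈k*2/2⌉ : ∀ k → ⌈ k ℕ.* 2 /2⌉ ≡ k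
⌈k*2/2⌉ zero    = refl
⌈k*2/2⌉ (suc k) = cong suc (⌈k*2/2⌉ k)

joins-unique : ∀ {m} {G : Graph m} (e : Edge G) {u v u′ v′} → Joins e u v → Joins e u′ v′ →
               (u ≡ u′ × v ≡ v′) ⊎ (u ≡ v′ × v ≡ u′)
joins-unique e (inj₁ (refl , refl)) q                    = q
joins-unique e (inj₂ (refl , refl)) (inj₁ (refl , refl)) = inj₂ (refl , refl)
joins-unique e (inj₂ (refl , refl)) (inj₂ (refl , refl)) = inj₁ (refl , refl)

module Wheel (n : ℕ) (n≥3 : 3 ≤ n) where

  W : Graph (1 + n)
  W = wheel n n≥3

  -- The rim vertex k mod n.
  rim : ℕ → Fin n
  rim zero    = fromℕ< (ℕ.≤-trans (s≤s z≤n) n≥3)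
  rim (suc k) = proj₁ (successor (rim k))

  rim-next : ∀ k → Next (rim k) (rim (suc k))
  rim-next k = proj₂ (successor (rim k))

  toℕ-rim : ∀ {k} → k < n → toℕ (rim k) ≡ k
  toℕ-rim {zero}  k<n = Fin.toℕ-fromℕ< _
  toℕ-rim {suc k} k<n with rim-next k | toℕ-rim {k} (ℕ.<-trans (ℕ.n<1+n k) k<n)
  ... | inj₁ eq       | ih = trans eq (cong suc ih)
  ... | inj₂ (eq , _) | ih = ⊥-elim (ℕ.<⇒≢ k<n (trans (cong suc (sym ih)) eq))

  rim-toℕ : ∀ i → rim (toℕ i) ≡ i
  rim-toℕ i = Fin.toℕ-injective (toℕ-rim (Fin.toℕ<n i))

  rim-injective : ∀ {j k} → j < n → k < n → rim j ≡ rim k → j ≡ k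
  rim-injective j<n k<n eq = trans (sym (toℕ-rim j<n)) (trans (cong toℕ eq) (toℕ-rim k<n))

  rim-suc-injective : ∀ j k → rim (suc j) ≡ rim (suc k) → rim j ≡ rim k
  rim-suc-injective j k eq =
    next-injective (rim-next j) (subst (Next (rim k)) (sym eq) (rim-next k))

  -- Cancelling successors reduces to `k = 0`, where 0 and 2 are distinct positions because `n` is
  -- at least 3.
  rim-+2 : ∀ k → rim (2 + k) ≢ rim k
  rim-+2 zero    eq with () ← rim-injective n≥3 (ℕ.≤-trans (s≤s z≤n) n≥3) eq
  rim-+2 (suc k) eq = rim-+2 k (rim-suc-injective (2 + k) k eq)

  rim-adjacent : ∀ k → Adj W (suc (rim k)) (suc (rim (suc k)))
  rim-adjacent k = fromWitness {a? = cyclicAdj? (rim k) (rim (suc k))} (inj₁ (rim-next k))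

  rim-suc-≢ : ∀ k → rim k ≢ rim (suc k)
  rim-suc-≢ k eq = Graph.adj-irrefl W (suc (rim k))
    (subst (λ i → Adj W (suc (rim k)) (suc i)) (sym eq) (rim-adjacent k))

  -- The edges come in the order first spoke, rim edge, second spoke; later case distinctions follow
  -- this order.
  triangle : ℕ → Cycle W
  triangle k = cycle zero
    (_∷_ {v = suc (rim k)} tt (_∷_ {v = suc (rim (suc k))} (rim-adjacent k) (tt ∷ [])))
    (s≤s (s≤s (s≤s z≤n)))
    (((λ ()) ∷ (λ ()) ∷ []) ∷ ((rim-suc-≢ k ∘ Fin.suc-injective) ∷ []) ∷ [] ∷ [])

  triangleSign : Signature W → ℕ → Sign
  triangleSign σ k = cycleSign σ (triangle k)

  module _ (σ : Signature W) where

    spokeSign : Fin n → Sign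
    spokeSign i = sgn σ zero (suc i) tt

    rimSign : ℕ → Sign
    rimSign k = sgn σ (suc (rim k)) (suc (rim (suc k))) (rim-adjacent k)

    -- The cycle returns to the hub along the second spoke, against the orientation used by
    -- `spokeSign`.
    triangleSign-≡ : ∀ k → triangleSign σ k ≡
                     spokeSign (rim k) * (rimSign k * (spokeSign (rim (suc k)) * pos))
    triangleSign-≡ k = cong (λ s → spokeSign (rim k) * (rimSign k * (s * pos)))
                            (sgn-sym σ (suc (rim (suc k))) zero tt tt)

  rim-edge : ∀ {i j} → Next i j → ∃[ k ] k < n × i ≡ rim k × j ≡ rim (suc k)
  rim-edge {i} {j} i→j = toℕ i , Fin.toℕ<n i , sym (rim-toℕ i) ,
    next-functional i→j (subst (λ k → Next k (rim (suc (toℕ i)))) (rim-toℕ i) (rim-next (toℕ i)))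

  -- Reduces a symmetric property of rim edges to the forward orientation from `rim k` to
  -- `rim (suc k)`.
  rim-sgn : (σ : Signature W) (P : Fin n → Fin n → Sign → Set) →
            (∀ {i j s} → P i j s → P j i s) →
            (∀ k → k < n → P (rim k) (rim (suc k)) (rimSign σ k)) →
            ∀ i j p → P i j (sgn σ (suc i) (suc j) p)
  rim-sgn σ P P-sym P-rim i j p with toWitness {a? = cyclicAdj? i j} p
  ... | inj₁ i→j with rim-edge i→j
  ...   | k , k<n , refl , refl =
    subst (λ q → P _ _ (sgn σ _ _ q)) (T-irrelevant (rim-adjacent k) p) (P-rim k k<n)
  rim-sgn σ P P-sym P-rim i j p | inj₂ j→i with rim-edge j→i
  ...   | k , k<n , refl , refl =
    P-sym (subst (P _ _) (sgn-sym σ _ _ (rim-adjacent k) p) (P-rim k k<n))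

  -- Upper bound from closed labellings, lower bound from negative triangles.

  module _ (σ : Signature W) where

    module _ (x : ℕ → Sign) (x-closed : x n ≡ x 0) where

      potential : Fin (1 + n) → Sign
      potential zero    = pos
      potential (suc i) = spokeSign σ i * x (toℕ i)

      unsatisfied : Sign → Edge W → List (Edge W)
      unsatisfied pos e = []
      unsatisfied neg e = [ e ]

      length-unsatisfied : ∀ s e → length (unsatisfied s e) ≡ penalty s
      length-unsatisfied pos e = refl
      length-unsatisfied neg e = refl

      deletions : ℕ → List (Edge W)
      deletions k =
        unsatisfied (x k) (edge zero (suc (rim k)) tt) ++
        unsatisfied (triangleSign σ k * (x k * x (suc k)))
                    (edge (suc (rim k)) (suc (rim (suc k))) (rim-adjacent k))

      length-deletions : ∀ k → length (deletions k) ≡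
                         penalty (x k) + penalty (triangleSign σ k * (x k * x (suc k)))
      length-deletions k = trans (length-++ (unsatisfied (x k) _))
        (cong₂ _+_ (length-unsatisfied (x k) _) (length-unsatisfied (triangleSign σ k * _) _))

      ds : List (Edge W)
      ds = concat (applyUpTo deletions n)

      deleted : ∀ {u v k} → k < n → Deleted W (deletions k) u v → Deleted W ds u v
      deleted k<n d = Any.concat⁺ (Any.applyUpTo⁺ deletions d k<n)

      -- Only the last triangle wraps around: its second rim vertex is 0 rather than `n`, and
      -- `x-closed` identifies the labels.
      x-rim-suc : ∀ {k} → k < n → x (toℕ (rim (suc k))) ≡ x (suc k)
      x-rim-suc {k} k<n with rim-next k
      ... | inj₁ eq         = cong x (trans eq (cong suc (toℕ-rim k<n)))
      ... | inj₂ (eq , eq₀) = trans (cong x eq₀)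
        (trans (sym x-closed) (cong x (trans (sym eq) (cong suc (toℕ-rim k<n)))))

      Satisfied : Fin (1 + n) → Fin (1 + n) → Sign → Set
      Satisfied u v s = Deleted W ds u v ⊎ s ≡ potential u * potential v

      satisfied-sym : ∀ {u v s} → Satisfied u v s → Satisfied v u s
      satisfied-sym (inj₁ d) = inj₁ (Any.map swap d)
      satisfied-sym {u} {v} (inj₂ eq) = inj₂ (trans eq (Sign.*-comm (potential u) (potential v)))

      spoke-satisfied : ∀ i → Satisfied zero (suc i) (spokeSign σ i)
      spoke-satisfied i with x (toℕ i) in eq
      ... | pos = inj₂ (sym (Sign.*-identityʳ (spokeSign σ i)))
      ... | neg = inj₁ (deleted (Fin.toℕ<n i) (Any.++⁺ˡ
        (subst (λ s → Deleted W (unsatisfied s (edge zero (suc (rim (toℕ i))) tt)) zero (suc i)) (sym eq)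
          (here (inj₁ (refl , cong suc (rim-toℕ i)))))))

      -- The edge is kept when the triangle sign is `x k * x (suc k)`; cancelling both spoke signs
      -- leaves its own sign as a product of potentials.
      rim-satisfied : ∀ k → k < n → Satisfied (suc (rim k)) (suc (rim (suc k))) (rimSign σ k)
      rim-satisfied k k<n with triangleSign σ k * (x k * x (suc k)) in eq
      ... | neg = inj₁ (deleted k<n (Any.++⁺ʳ (unsatisfied (x k) _)
        (subst (λ s → Deleted W (unsatisfied s _) _ _) (sym eq) (here (inj₁ (refl , refl))))))
      ... | pos = inj₂ (trans
        (cancel (spokeSign σ (rim k)) (spokeSign σ (rim (suc k))) (rimSign σ k) (x k) (x (suc k))
          (trans (cong (_* (x k * x (suc k))) (sym (triangleSign-≡ σ k))) eq))
        (cong₂ (λ y z → (spokeSign σ (rim k) * y) * (spokeSign σ (rim (suc k)) * z))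
          (cong x (sym (toℕ-rim k<n))) (sym (x-rim-suc k<n))))
        where
        cancel : ∀ a b r y z → (a * (r * (b * pos))) * (y * z) ≡ pos → r ≡ (a * y) * (b * z)
        cancel = toWitness {a? = forallSigns? λ a → forallSigns? λ b → forallSigns? λ r →
          forallSigns? λ y → forallSigns? λ z →
          ((a * (r * (b * pos))) * (y * z) Sign.≟ pos) →-dec (r Sign.≟ (a * y) * (b * z))} tt

      satisfied : ∀ u v p → Satisfied u v (sgn σ u v p)
      satisfied zero    zero    p = ⊥-elim (Graph.adj-irrefl W zero p)
      satisfied zero    (suc i) p = spoke-satisfied i
      satisfied (suc i) zero    p = satisfied-sym {zero} {suc i}
        (subst (Satisfied zero (suc i)) (sgn-sym σ zero (suc i) tt p) (spoke-satisfied i))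
      satisfied (suc i) (suc j) p =
        rim-sgn σ (λ i j → Satisfied (suc i) (suc j)) (λ {i} {j} → satisfied-sym {suc i} {suc j})
                rim-satisfied i j p

      frustrationIndex≤cost : frustrationIndex σ ≤ cost (triangleSign σ) x n
      frustrationIndex≤cost = subst (frustrationIndex σ ≤_)
        (length-concat-applyUpTo length-deletions n)
        (frustrationIndex≤length σ potential ds satisfied)

    closed-bound : ∀ {m c} → n ≡ m → Closed (triangleSign σ) m c → frustrationIndex σ ≤ c
    closed-bound refl (_ , L) =
      ℕ.≤-trans (frustrationIndex≤cost (label L) (trans (end L) (sym (start L)))) (cheap L)

    -- Every triangle contains a deleted edge, and an edge lies in at most two triangles; an
    -- injection into pairs of a deleted edge and a bit counts this.
    n≤frustrationIndex*2 : (∀ k → k < n → triangleSign σ k ≡ neg) → n ≤ frustrationIndex σ ℕ.* 2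
    n≤frustrationIndex*2 negative with proj₁ (frustrationIndex-least σ)
    ... | ds , _ , len , balanced = subst (λ l → n ≤ l ℕ.* 2) len
        (Fin.injective⇒≤ {f = λ i → code (toℕ i) (hit i)} code-injective)
      where
      -- The first spoke and the rim edge can share a class, since no edge is both a spoke and a rim
      -- edge; within each class an edge determines its triangle.
      HitsFirst : Edge W → ℕ → Set
      HitsFirst e k = Joins e zero (suc (rim k)) ⊎ Joins e (suc (rim k)) (suc (rim (suc k)))

      HitsSecond : Edge W → ℕ → Set
      HitsSecond e k = Joins e (suc (rim (suc k))) zero

      Hit : ℕ → Set
      Hit k = ∃[ d ] (HitsFirst (lookup ds d) k ⊎ HitsSecond (lookup ds d) k)

      hit : ∀ i → Hit (toℕ i)
      hit i with negativeCycle-hit σ ds balanced (triangle (toℕ i)) (negative (toℕ i) (Fin.toℕ<n i))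
      ... | here d                 = index d , inj₁ (inj₁ (Any.lookup-index d))
      ... | there (here d)         = index d , inj₁ (inj₂ (Any.lookup-index d))
      ... | there (there (here d)) = index d , inj₂ (Any.lookup-index d)

      -- A deleted spoke meets two triangles; the second component tells them apart.
      code : ∀ k → Hit k → Fin (length ds ℕ.* 2)
      code k (d , inj₁ _) = combine d zero
      code k (d , inj₂ _) = combine d (suc zero)

      hitsFirst-injective : ∀ e j k → HitsFirst e j → HitsFirst e k → rim j ≡ rim k
      hitsFirst-injective e j k (inj₁ p) (inj₁ q) with joins-unique e p q
      ... | inj₁ (_ , eq) = Fin.suc-injective eq
      hitsFirst-injective e j k (inj₁ p) (inj₂ q) with joins-unique e p q
      ... | inj₁ (() , _)
      ... | inj₂ (() , _)
      hitsFirst-injective e j k (inj₂ p) (inj₁ q) with joins-unique e p q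
      ... | inj₁ (() , _)
      ... | inj₂ (_ , ())
      hitsFirst-injective e j k (inj₂ p) (inj₂ q) with joins-unique e p q
      ... | inj₁ (eq , _)   = Fin.suc-injective eq
      -- Opposite orientations would make `rim k` its own second successor.
      ... | inj₂ (eq , eq′) = ⊥-elim (rim-+2 k
        (trans (sym (cong (proj₁ ∘ successor) (Fin.suc-injective eq))) (Fin.suc-injective eq′)))

      hitsSecond-injective : ∀ e j k → HitsSecond e j → HitsSecond e k → rim j ≡ rim k
      hitsSecond-injective e j k p q with joins-unique e p q
      ... | inj₁ (eq , _) = rim-suc-injective j k (Fin.suc-injective eq)

      code-rim : ∀ j k (h : Hit j) (h′ : Hit k) → code j h ≡ code k h′ → rim j ≡ rim k
      code-rim j k (d , inj₁ p) (d′ , inj₁ q) eq with Fin.combine-injective d zero d′ zero eq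
      ... | refl , _ = hitsFirst-injective (lookup ds d) j k p q
      code-rim j k (d , inj₁ p) (d′ , inj₂ q) eq with Fin.combine-injective d zero d′ (suc zero) eq
      ... | _ , ()
      code-rim j k (d , inj₂ p) (d′ , inj₁ q) eq with Fin.combine-injective d (suc zero) d′ zero eq
      ... | _ , ()
      code-rim j k (d , inj₂ p) (d′ , inj₂ q) eq
        with Fin.combine-injective d (suc zero) d′ (suc zero) eq
      ... | refl , _ = hitsSecond-injective (lookup ds d) j k p q

      code-injective : ∀ {i j} → code (toℕ i) (hit i) ≡ code (toℕ j) (hit j) → i ≡ j
      code-injective {i} {j} eq =
        trans (sym (rim-toℕ i)) (trans (code-rim (toℕ i) (toℕ j) (hit i) (hit j) eq) (rim-toℕ j))

  -- Edge-disjoint triangles at alternate positions.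

  triangle-edgeDisjoint : ∀ a b → rim a ≢ rim b → rim a ≢ rim (suc b) → rim (suc a) ≢ rim b →
                          EdgeDisjoint (triangle a) (triangle b)
  -- One block per edge of `triangle a`, one entry per edge of `triangle b`. Equal second spokes
  -- would force equal first rim vertices, by `rim-suc-injective`.
  triangle-edgeDisjoint a b ≢₁ ≢₂ ≢₃ =
    ( (λ { (inj₁ (_ , eq)) → ≢₁ (Fin.suc-injective eq) ; (inj₂ (() , _)) })
    ∷ (λ { (inj₁ (() , _)) ; (inj₂ (() , _)) })
    ∷ (λ { (inj₁ (() , _)) ; (inj₂ (_ , eq)) → ≢₂ (Fin.suc-injective eq) }) ∷ [])
    ∷
    ( (λ { (inj₁ (() , _)) ; (inj₂ (_ , ())) })
    ∷ (λ { (inj₁ (eq , _)) → ≢₁ (Fin.suc-injective eq) ; (inj₂ (eq , _)) → ≢₂ (Fin.suc-injective eq) })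
    ∷ (λ { (inj₁ (_ , ())) ; (inj₂ (() , _)) }) ∷ [])
    ∷
    ( (λ { (inj₁ (() , _)) ; (inj₂ (eq , _)) → ≢₃ (Fin.suc-injective eq) })
    ∷ (λ { (inj₁ (_ , ())) ; (inj₂ (_ , ())) })
    ∷ (λ { (inj₁ (eq , _)) → ≢₁ (rim-suc-injective a b (Fin.suc-injective eq)) ; (inj₂ (() , _)) }) ∷ [])
    ∷ []

  -- A shifted position can reach `n`, out of range for `rim-injective`; injectivity of the
  -- successor removes the offset first.
  rim-+-cancelˡ : ∀ o {j k} → rim (o + j) ≡ rim (o + k) → rim j ≡ rim k
  rim-+-cancelˡ zero            eq = eq
  rim-+-cancelˡ (suc o) {j} {k} eq = rim-+-cancelˡ o (rim-suc-injective (o + j) (o + k) eq)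

  -- The offset `o` selects the parity class. As `n` is even, triangles of one class are never
  -- neighbours, even across the wrap-around.
  alternateTriangles : (σ : Signature W) → ∀ k o → n ≡ k ℕ.* 2 →
                       (∀ (i : Fin k) → triangleSign σ (o + toℕ i ℕ.* 2) ≡ neg) →
                       DisjointNegativeTriangles σ k
  alternateTriangles σ k o n≡2k negative =
    (λ i → triangle (o + toℕ i ℕ.* 2) , refl , negative i) , λ i j i≢j →
    triangle-edgeDisjoint (o + toℕ i ℕ.* 2) (o + toℕ j ℕ.* 2)
      (λ eq → i≢j (Fin.toℕ-injective (ℕ.*-cancelʳ-≡ _ _ 2
                (rim-injective (double<n i) (double<n j) (rim-+-cancelˡ o eq)))))
      (rim-even≢odd i j)
      (rim-even≢odd j i ∘ sym)
    where
    double+1<n : ∀ (i : Fin k) → suc (toℕ i ℕ.* 2) < n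
    double+1<n i = subst (_ ≤_) (sym n≡2k) (ℕ.*-monoˡ-≤ 2 (Fin.toℕ<n i))

    double<n : ∀ (i : Fin k) → toℕ i ℕ.* 2 < n
    double<n i = ℕ.<-trans (ℕ.n<1+n _) (double+1<n i)

    rim-even≢odd : ∀ i j → rim (o + toℕ i ℕ.* 2) ≢ rim (suc (o + toℕ j ℕ.* 2))
    rim-even≢odd i j eq = ℕ.even≢odd (toℕ i) (toℕ j)
      (trans (ℕ.*-comm 2 (toℕ i))
        (trans (rim-injective (double<n i) (double+1<n j)
                 (rim-+-cancelˡ o (trans eq (cong rim (sym (ℕ.+-suc o _))))))
               (cong suc (ℕ.*-comm (toℕ j) 2))))

  -- Negative triangles and the switching class of the all-negative wheel.

  switchingEquivalent⇒negative : (σ : Signature W) → SwitchingEquivalent (allNegative W) σ →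
                                 ∀ k → triangleSign σ k ≡ neg
  switchingEquivalent⇒negative σ (X , eq) k =
    trans (sym (walkSign-cong {σ = switch X (allNegative W)} {τ = σ} eq (walk (triangle k))))
          (odd-negative (Vec.lookup X zero) (Vec.lookup X (suc (rim k))) (Vec.lookup X (suc (rim (suc k)))))
    where
    -- Membership in `X` changes an even number of times around a triangle, so an odd number of its
    -- edges stay negative.
    odd-negative : ∀ a b c →
      (if a xor b then pos else neg) * ((if b xor c then pos else neg) *
      ((if c xor a then pos else neg) * pos)) ≡ neg
    odd-negative false false false = refl
    odd-negative false false true  = refl
    odd-negative false true  false = refl
    odd-negative false true  true  = refl
    odd-negative true  false false = refl
    odd-negative true  false true  = refl
    odd-negative true  true  false = refl
    odd-negative true  true  true  = refl

  -- Switching at the rim vertices with positive spokes makes all spokes agree with `σ`; the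
  -- negative triangles then force the rim signs.
  negative⇒switchingEquivalent : (σ : Signature W) → (∀ k → k < n → triangleSign σ k ≡ neg) →
                                 SwitchingEquivalent (allNegative W) σ
  negative⇒switchingEquivalent σ negative = Vec.tabulate side , λ u v p →
    trans (cong₂ (λ a b → if a xor b then pos else neg)
                 (lookup∘tabulate side u) (lookup∘tabulate side v)) (agree u v p)
    where
    isPos : Sign → Bool
    isPos pos = true
    isPos neg = false

    side : Fin (1 + n) → Bool
    side zero    = false
    side (suc i) = isPos (spokeSign σ i)

    Agree : Fin (1 + n) → Fin (1 + n) → Sign → Set
    Agree u v s = (if side u xor side v then pos else neg) ≡ s

    agree-sym : ∀ u v {s} → Agree u v s → Agree v u s
    agree-sym u v = trans (cong (if_then pos else neg) (xor-comm (side v) (side u)))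

    spoke-agree : ∀ i → Agree zero (suc i) (spokeSign σ i)
    spoke-agree i with spokeSign σ i
    ... | pos = refl
    ... | neg = refl

    rim-agree : ∀ k → k < n → Agree (suc (rim k)) (suc (rim (suc k))) (rimSign σ k)
    rim-agree k k<n = solve (spokeSign σ (rim k)) (spokeSign σ (rim (suc k))) (rimSign σ k)
      (trans (sym (triangleSign-≡ σ k)) (negative k k<n))
      where
      solve : ∀ a b r → a * (r * (b * pos)) ≡ neg → (if isPos a xor isPos b then pos else neg) ≡ r
      solve = toWitness {a? = forallSigns? λ a → forallSigns? λ b → forallSigns? λ r →
        (a * (r * (b * pos)) Sign.≟ neg) →-dec ((if isPos a xor isPos b then pos else neg) Sign.≟ r)} tt

    agree : ∀ u v p → Agree u v (sgn σ u v p)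
    agree zero    zero    p = ⊥-elim (Graph.adj-irrefl W zero p)
    agree zero    (suc i) p = spoke-agree i
    agree (suc i) zero    p = agree-sym zero (suc i)
      (trans (spoke-agree i) (sgn-sym σ zero (suc i) tt p))
    agree (suc i) (suc j) p = rim-sgn σ (λ i j → Agree (suc i) (suc j))
      (λ {i} {j} → agree-sym (suc i) (suc j)) rim-agree i j p

  -- The maximum and the signatures attaining it.

  frustrationIndex≤⌈n/2⌉ : (σ : Signature W) → frustrationIndex σ ≤ ⌈ n /2⌉
  frustrationIndex≤⌈n/2⌉ σ = go (parity n) refl
    where
    go : ∀ {m} → Parity m → n ≡ m → frustrationIndex σ ≤ ⌈ n /2⌉
    go (even k) eq = subst (frustrationIndex σ ≤_) (sym (trans (cong ⌈_/2⌉ eq) (⌈k*2/2⌉ k)))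
      (closed-bound σ eq (closed-even _ k))
    go (odd k)  eq = subst (frustrationIndex σ ≤_) (sym (trans (cong ⌈_/2⌉ eq) (cong suc (⌊k*2/2⌋ k))))
      (closed-bound σ eq (closed-odd _ k))

  negative⇒frustrationIndex : (σ : Signature W) → (∀ k → k < n → triangleSign σ k ≡ neg) →
                              frustrationIndex σ ≡ ⌈ n /2⌉
  negative⇒frustrationIndex σ negative = ℕ.≤-antisym (frustrationIndex≤⌈n/2⌉ σ)
    -- Applying the monotone `⌈_/2⌉` to `n ≤ frustrationIndex σ * 2` rounds the bound up for odd
    -- `n`.
    (subst (⌈ n /2⌉ ≤_) (⌈k*2/2⌉ (frustrationIndex σ))
           (ℕ.⌈n/2⌉-mono (n≤frustrationIndex*2 σ negative)))

  allNegative-frustrationIndex : frustrationIndex (allNegative W) ≡ ⌈ n /2⌉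
  allNegative-frustrationIndex = negative⇒frustrationIndex (allNegative W) λ _ _ → refl

  maxFrustrationIndex-≡ : maxFrustrationIndex W ≡ ⌈ n /2⌉
  maxFrustrationIndex-≡ with maxFrustrationIndex-greatest W
  ... | (σ , attained) , maximal = ℕ.≤-antisym
    (subst (_≤ ⌈ n /2⌉) attained (frustrationIndex≤⌈n/2⌉ σ))
    (maximal _ (allNegative W , allNegative-frustrationIndex))

  odd-maximal⇒negative : (σ : Signature W) → ∀ k → n ≡ suc (k ℕ.* 2) → k < frustrationIndex σ →
                         ∀ j → j < n → triangleSign σ j ≡ neg
  odd-maximal⇒negative σ k n≡ k<l j j<n with triangleSign σ j in eq
  ... | neg = refl
  ... | pos = ⊥-elim (ℕ.<⇒≱ k<l (closed-bound σ n≡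
                (closed-odd-positive _ k j (subst (j <_) n≡ j<n) eq)))

  -- If neither parity class is entirely negative, a closed labelling saves one deletion,
  -- contradicting the lower bound `k`.
  even-maximal⇒disjointTriangles : (σ : Signature W) → ∀ k → n ≡ k ℕ.* 2 → k ≤ frustrationIndex σ →
                                   DisjointNegativeTriangles σ k
  even-maximal⇒disjointTriangles σ zero    n≡ _ = alternateTriangles σ 0 0 n≡ λ ()
  even-maximal⇒disjointTriangles σ (suc k) n≡ k<l =
    [ alternateTriangles σ (suc k) 0 n≡
    , [ alternateTriangles σ (suc k) 1 n≡
      , (λ closed → ⊥-elim (ℕ.<⇒≱ k<l (closed-bound σ n≡ closed)))
      ]′
    ]′ (alternating-or-closed (triangleSign σ) k)

corollary25 : (n : ℕ) (n≥3 : 3 ≤ n) →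
    let W = wheel n n≥3 in
    (maxFrustrationIndex W ≡ frustrationIndex (allNegative W) ×
    frustrationIndex (allNegative W) ≡ ⌈ n /2⌉) ×
    (¬ (2 ∣ n) → (σ : Signature W) →
    (frustrationIndex σ ≡ maxFrustrationIndex W) ⇔ SwitchingEquivalent (allNegative W) σ) ×
    (2 ∣ n → (σ : Signature W) →
    (frustrationIndex σ ≡ maxFrustrationIndex W) ⇔ DisjointNegativeTriangles σ ⌊ n /2⌋)
corollary25 n n≥3 =
  (trans maxFrustrationIndex-≡ (sym allNegative-frustrationIndex) , allNegative-frustrationIndex) ,
  (λ 2∤n σ → oddCase (parity n) refl 2∤n σ) , evenCase
  where
  open Wheel n n≥3

  oddCase : ∀ {m} → Parity m → n ≡ m → ¬ (2 ∣ n) → (σ : Signature W) →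
            (frustrationIndex σ ≡ maxFrustrationIndex W) ⇔ SwitchingEquivalent (allNegative W) σ
  oddCase (even k) eq 2∤n σ = ⊥-elim (2∤n (divides k eq))
  oddCase (odd k)  eq 2∤n σ = mk⇔
    (λ maximal → negative⇒switchingEquivalent σ (odd-maximal⇒negative σ k eq
      (ℕ.≤-reflexive (sym (trans maximal (trans maxFrustrationIndex-≡
        (trans (cong ⌈_/2⌉ eq) (cong suc (⌊k*2/2⌋ k)))))))))
    (λ equivalent → trans
      (negative⇒frustrationIndex σ λ k _ → switchingEquivalent⇒negative σ equivalent k)
      (sym maxFrustrationIndex-≡))

  evenCase : 2 ∣ n → (σ : Signature W) →
             (frustrationIndex σ ≡ maxFrustrationIndex W) ⇔ DisjointNegativeTriangles σ ⌊ n /2⌋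
  evenCase (divides k eq) σ = mk⇔
    (λ maximal → subst (DisjointNegativeTriangles σ) (sym ⌊n/2⌋≡k)
      (even-maximal⇒disjointTriangles σ k eq
        (ℕ.≤-reflexive (sym (trans maximal (trans maxFrustrationIndex-≡ ⌈n/2⌉≡k))))))
    -- For even `n` floor and ceiling agree, so the disjoint triangles force as many deletions as
    -- always suffice.
    (λ triangles → trans (ℕ.≤-antisym
        (subst (frustrationIndex σ ≤_) ⌈n/2⌉≡k (frustrationIndex≤⌈n/2⌉ σ))
        (subst (_≤ frustrationIndex σ) ⌊n/2⌋≡k (disjointNegativeTriangles-≤ σ _ triangles)))
      (sym (trans maxFrustrationIndex-≡ ⌈n/2⌉≡k)))
    where
    ⌊n/2⌋≡k : ⌊ n /2⌋ ≡ k
    ⌊n/2⌋≡k = trans (cong ⌊_/2⌋ eq) (⌊k*2/2⌋ k)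

    ⌈n/2⌉≡k : ⌈ n /2⌉ ≡ k
    ⌈n/2⌉≡k = trans (cong ⌈_/2⌉ eq) (⌈k*2/2⌉ k)
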